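{- For every integer $n\ge 0$ let $$F_n(q)=\sum_{k=0}^{n}\frac{(q^{n-k+1};q)_{2k}}{(q^2;q^2)_k}\,q^{\binom{n-k}{2}}.$$ Then for every $n\ge 2$, $$F_n(q)+(q^{2n-1}-1)F_{n-1}(q)-q^{2n-3}F_{n-2}(q)=0.$$
   Context: Here $q$ is an indeterminate, and $(a;q)_m=(1-a)(1-aq)\cdots(1-aq^{m-1})$ is the $q$-shifted factorial, with $(a;q)_0=1$; thus $(q^2;q^2)_k=\prod_{i=1}^{k}(1-q^{2i})$ and $(q^{n-k+1};q)_{2k}=\prod_{i=n-k+1}^{n+k}(1-q^{i})$. The identity is one of rational functions (equivalently formal power series) in $q$. -}

module Defs where

open import Algebra.Bundles using (CommutativeRing)
open import Algebra.Structures using (IsCommutativeRing)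
import Algebra.Properties.Semiring.Exp as SemiringExp
import Algebra.Properties.Semiring.Sum as SemiringSum
open import Data.Fin.Base using (toℕ)
open import Data.Integer.Base as ℤ using (ℤ; 0ℤ; 1ℤ)
import Data.Integer.Properties as ℤₚ
open import Data.Integer.Tactic.RingSolver using (solve-∀)
open import Data.Nat.Base as ℕ using (ℕ; zero; suc; _∸_)
open import Data.Nat.Combinatorics using (_C_)
open import Data.Nat.Induction using (<-wellFounded; <-rec; <-Rec)
import Data.Nat.Properties as ℕₚ
open import Data.Product.Base using (_,_)
open import Induction.WellFounded using (module FixPoint)
open import Level using (0ℓ)
open import Relation.Binary.PropositionalEquality
  using (_≡_; _≗_; refl; sym; trans; cong; cong₂; module ≡-Reasoning)

------------------------------------------------------------------------
-- The ring ℤ⟦q⟧ of formal power series with integer coefficients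

Series : Set
Series = ℕ → ℤ

private
  module ℤ∑ = SemiringSum (CommutativeRing.semiring ℤₚ.+-*-commutativeRing)

  infixl 6 _⊕_
  infixl 7 _⊛_
  infix  8 ⊖_

  _⊕_ _⊛_ : Series → Series → Series
  (f ⊕ g) n = f n ℤ.+ g n
  (f ⊛ g) n = ℤ∑.sum {suc n} λ i → f (toℕ i) ℤ.* g (n ∸ toℕ i)

  ⊖_ : Series → Series
  (⊖ f) n = ℤ.- f n

  𝟘 𝟙 : Series
  𝟘 _       = 0ℤ
  𝟙 zero    = 1ℤ
  𝟙 (suc _) = 0ℤ

  tail : Series → Series
  tail f n = f (suc n)

  open ≡-Reasoning

  ⊛-cong : ∀ {f f′ g g′} → f ≗ f′ → g ≗ g′ → f ⊛ g ≗ f′ ⊛ g′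
  ⊛-cong f≗f′ g≗g′ n = ℤ∑.sum-cong-≗ {suc n} λ i →
    cong₂ ℤ._*_ (f≗f′ (toℕ i)) (g≗g′ (n ∸ toℕ i))

  ⊛-sucʳ : ∀ f g n → (f ⊛ g) (suc n) ≡ (f ⊛ tail g) n ℤ.+ f (suc n) ℤ.* g 0
  ⊛-sucʳ f g zero = lemma (f 0 ℤ.* g 1) (f 1 ℤ.* g 0)
    where
    lemma : ∀ x y → x ℤ.+ (y ℤ.+ 0ℤ) ≡ x ℤ.+ 0ℤ ℤ.+ y
    lemma = solve-∀
  ⊛-sucʳ f g (suc n) = trans
    (cong (λ x → f 0 ℤ.* g (2 ℕ.+ n) ℤ.+ x) (⊛-sucʳ (tail f) g n))
    (sym (ℤₚ.+-assoc (f 0 ℤ.* g (2 ℕ.+ n)) _ _))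

  ⊛-comm : ∀ f g → f ⊛ g ≗ g ⊛ f
  ⊛-comm f g zero    = cong (ℤ._+ 0ℤ) (ℤₚ.*-comm (f 0) (g 0))
  ⊛-comm f g (suc n) = begin
    f 0 ℤ.* g (suc n) ℤ.+ (tail f ⊛ g) n  ≡⟨ ℤₚ.+-comm (f 0 ℤ.* g (suc n)) _ ⟩
    (tail f ⊛ g) n ℤ.+ f 0 ℤ.* g (suc n)  ≡⟨ cong₂ ℤ._+_ (⊛-comm (tail f) g n) (ℤₚ.*-comm (f 0) _) ⟩
    (g ⊛ tail f) n ℤ.+ g (suc n) ℤ.* f 0  ≡⟨ ⊛-sucʳ g f n ⟨
    (g ⊛ f) (suc n)                       ∎

  ⊛-distribʳ : ∀ h f g → (f ⊕ g) ⊛ h ≗ f ⊛ h ⊕ g ⊛ h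
  ⊛-distribʳ h f g n = trans
    (ℤ∑.sum-cong-≗ {suc n} λ i → ℤₚ.*-distribʳ-+ (h (n ∸ toℕ i)) (f (toℕ i)) (g (toℕ i)))
    (ℤ∑.∑-distrib-+ {suc n} (λ i → f (toℕ i) ℤ.* h (n ∸ toℕ i)) (λ i → g (toℕ i) ℤ.* h (n ∸ toℕ i)))

  ⊛-distribˡ : ∀ h f g → h ⊛ (f ⊕ g) ≗ h ⊛ f ⊕ h ⊛ g
  ⊛-distribˡ h f g n = begin
    (h ⊛ (f ⊕ g)) n             ≡⟨ ⊛-comm h (f ⊕ g) n ⟩
    ((f ⊕ g) ⊛ h) n             ≡⟨ ⊛-distribʳ h f g n ⟩
    (f ⊛ h) n ℤ.+ (g ⊛ h) n     ≡⟨ cong₂ ℤ._+_ (⊛-comm f h n) (⊛-comm g h n) ⟩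
    (h ⊛ f) n ℤ.+ (h ⊛ g) n     ∎

  ⊛-scaleˡ : ∀ c f g → (λ n → c ℤ.* f n) ⊛ g ≗ (λ n → c ℤ.* (f ⊛ g) n)
  ⊛-scaleˡ c f g n = trans
    (ℤ∑.sum-cong-≗ {suc n} λ i → ℤₚ.*-assoc c (f (toℕ i)) (g (n ∸ toℕ i)))
    (sym (ℤ∑.*-distribˡ-sum {suc n} c (λ i → f (toℕ i) ℤ.* g (n ∸ toℕ i))))

  ⊛-assoc : ∀ f g h → (f ⊛ g) ⊛ h ≗ f ⊛ (g ⊛ h)
  ⊛-assoc f g h zero = lemma (f 0) (g 0) (h 0)
    where
    lemma : ∀ x y z → (x ℤ.* y ℤ.+ 0ℤ) ℤ.* z ℤ.+ 0ℤ ≡ x ℤ.* (y ℤ.* z ℤ.+ 0ℤ) ℤ.+ 0ℤ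
    lemma = solve-∀
  ⊛-assoc f g h (suc n) = begin
    (f 0 ℤ.* g 0 ℤ.+ 0ℤ) ℤ.* h (suc n) ℤ.+ (((λ m → f 0 ℤ.* tail g m) ⊕ tail f ⊛ g) ⊛ h) n
      ≡⟨ cong (λ x → (f 0 ℤ.* g 0 ℤ.+ 0ℤ) ℤ.* h (suc n) ℤ.+ x)
           (trans (⊛-distribʳ h (λ m → f 0 ℤ.* tail g m) (tail f ⊛ g) n)
                  (cong₂ ℤ._+_ (⊛-scaleˡ (f 0) (tail g) h n) (⊛-assoc (tail f) g h n))) ⟩
    (f 0 ℤ.* g 0 ℤ.+ 0ℤ) ℤ.* h (suc n) ℤ.+ (f 0 ℤ.* (tail g ⊛ h) n ℤ.+ (tail f ⊛ (g ⊛ h)) n)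
      ≡⟨ lemma (f 0) (g 0) (h (suc n)) ((tail g ⊛ h) n) ((tail f ⊛ (g ⊛ h)) n) ⟩
    f 0 ℤ.* (g 0 ℤ.* h (suc n) ℤ.+ (tail g ⊛ h) n) ℤ.+ (tail f ⊛ (g ⊛ h)) n
      ∎
    where
    lemma : ∀ x y z u v → (x ℤ.* y ℤ.+ 0ℤ) ℤ.* z ℤ.+ (x ℤ.* u ℤ.+ v) ≡ x ℤ.* (y ℤ.* z ℤ.+ u) ℤ.+ v
    lemma = solve-∀

  ⊛-zeroˡ : ∀ f → 𝟘 ⊛ f ≗ 𝟘
  ⊛-zeroˡ f zero    = refl
  ⊛-zeroˡ f (suc n) = trans (ℤₚ.+-identityˡ _) (⊛-zeroˡ f n)

  ⊛-identityˡ : ∀ f → 𝟙 ⊛ f ≗ f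
  ⊛-identityˡ f zero    = trans (ℤₚ.+-identityʳ _) (ℤₚ.*-identityˡ (f 0))
  ⊛-identityˡ f (suc n) = trans
    (cong₂ ℤ._+_ (ℤₚ.*-identityˡ (f (suc n))) (⊛-zeroˡ f n)) (ℤₚ.+-identityʳ _)

  isCommutativeRing : IsCommutativeRing _≗_ _⊕_ _⊛_ ⊖_ 𝟘 𝟙
  isCommutativeRing = record
    { isRing = record
      { +-isAbelianGroup = record
        { isGroup = record
          { isMonoid = record
            { isSemigroup = record
              { isMagma = record
                { isEquivalence = record
                  { refl  = λ _ → refl
                  ; sym   = λ f≗g n → sym (f≗g n)
                  ; trans = λ f≗g g≗h n → trans (f≗g n) (g≗h n)
                  }
                ; ∙-cong = λ f≗f′ g≗g′ n → cong₂ ℤ._+_ (f≗f′ n) (g≗g′ n)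
                }
              ; assoc = λ f g h n → ℤₚ.+-assoc (f n) (g n) (h n)
              }
            ; identity = (λ f n → ℤₚ.+-identityˡ (f n)) , (λ f n → ℤₚ.+-identityʳ (f n))
            }
          ; inverse = (λ f n → ℤₚ.+-inverseˡ (f n)) , (λ f n → ℤₚ.+-inverseʳ (f n))
          ; ⁻¹-cong = λ f≗g n → cong ℤ.-_ (f≗g n)
          }
        ; comm = λ f g n → ℤₚ.+-comm (f n) (g n)
        }
      ; *-cong     = ⊛-cong
      ; *-assoc    = ⊛-assoc
      ; *-identity = ⊛-identityˡ , λ f n → trans (⊛-comm f 𝟙 n) (⊛-identityˡ f n)
      ; distrib    = ⊛-distribˡ , ⊛-distribʳ
      }
    ; *-comm = ⊛-comm
    }

ℤ⟦q⟧ : CommutativeRing 0ℓ 0ℓ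
ℤ⟦q⟧ = record { isCommutativeRing = isCommutativeRing }

open CommutativeRing ℤ⟦q⟧ public using (_≈_; _+_; _*_; _-_; -_; 0#; 1#)
open SemiringExp (CommutativeRing.semiring ℤ⟦q⟧) public using (_^_)
open SemiringSum (CommutativeRing.semiring ℤ⟦q⟧) public using (sum⁺-syntax)

-- The indeterminate.
q : Series
q 1 = 1ℤ
q _ = 0ℤ

------------------------------------------------------------------------
-- Division by a series with constant term 1

record ConstantTermOne (f : Series) : Set where
  constructor mkConstantTermOne
  field constantTerm : f 0 ≡ 1ℤ

open ConstantTermOne public

private
  recipStep : (f : Series) (n : ℕ) → <-Rec (λ _ → ℤ) n → ℤ
  recipStep f zero    rec = 1ℤ
  recipStep f (suc n) rec =
    ℤ.- ℤ∑.sum {suc n} (λ i → f (suc (toℕ i)) ℤ.* rec (ℕ.s≤s (ℕₚ.m∸n≤m n (toℕ i))))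

-- When f 0 ≡ 1 this is the inverse of f (see /-*-cancel); its
-- coefficients are given by the recurrence in recip-zero and recip-suc.
recip : Series → Series
recip f = <-rec (λ _ → ℤ) (recipStep f)

recip-zero : ∀ f → recip f 0 ≡ 1ℤ
recip-zero f = refl

recip-suc : ∀ f n →
  recip f (suc n) ≡ ℤ.- ℤ∑.sum {suc n} (λ i → f (suc (toℕ i)) ℤ.* recip f (n ∸ toℕ i))
recip-suc f n = FixPoint.unfold-wfRec <-wellFounded (λ _ → ℤ) (recipStep f) ext {suc n}
  where
  ext : ∀ m {r r′ : <-Rec (λ _ → ℤ) m} →
        (∀ {k} (k<m : k ℕ.< m) → r k<m ≡ r′ k<m) → recipStep f m r ≡ recipStep f m r′
  ext zero    eq = refl
  ext (suc m) eq = cong ℤ.-_ (ℤ∑.sum-cong-≗ {suc m} λ i → cong (f (suc (toℕ i)) ℤ.*_) (eq (ℕ.s≤s (ℕₚ.m∸n≤m m (toℕ i)))))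

infixl 7 _/_

_/_ : (f g : Series) → .{{ConstantTermOne g}} → Series
f / g = f * recip g

*-recip : ∀ f → ConstantTermOne f → f * recip f ≈ 1#
*-recip f f₀≡1 zero    = cong (λ x → x ℤ.* 1ℤ ℤ.+ 0ℤ) (constantTerm f₀≡1)
*-recip f f₀≡1 (suc n) = begin
  f 0 ℤ.* recip f (suc n) ℤ.+ s  ≡⟨ cong₂ (λ x y → x ℤ.* y ℤ.+ s) (constantTerm f₀≡1) (recip-suc f n) ⟩
  1ℤ ℤ.* (ℤ.- s) ℤ.+ s           ≡⟨ cong (ℤ._+ s) (ℤₚ.*-identityˡ (ℤ.- s)) ⟩
  ℤ.- s ℤ.+ s                    ≡⟨ ℤₚ.+-inverseˡ s ⟩
  0ℤ                             ∎
  where s = (tail f * recip f) n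

/-*-cancel : ∀ f g {{c : ConstantTermOne g}} → (f / g) * g ≈ f
/-*-cancel f g {{c}} = R.trans (R.*-assoc f (recip g) g)
  (R.trans (R.*-cong {f} {f} R.refl (R.trans (R.*-comm (recip g) g) (*-recip g c)))
           (R.*-identityʳ f))
  where module R = CommutativeRing ℤ⟦q⟧

------------------------------------------------------------------------
-- q-shifted factorials

-- ⟨ a ⨾ x ⟩ m is the q-shifted factorial (a ; x)ₘ with base x.
⟨_⨾_⟩_ : Series → Series → ℕ → Series
⟨ a ⨾ x ⟩ zero  = 1#
⟨ a ⨾ x ⟩ suc m = (⟨ a ⨾ x ⟩ m) * (1# - a * x ^ m)

q²-factorial-constantTermOne : ∀ k → ConstantTermOne (⟨ q ^ 2 ⨾ q ^ 2 ⟩ k)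
q²-factorial-constantTermOne zero    = mkConstantTermOne refl
q²-factorial-constantTermOne (suc k) = mkConstantTermOne
  (cong (λ x → x ℤ.* 1ℤ ℤ.+ 0ℤ) (constantTerm (q²-factorial-constantTermOne k)))

-- Only used for k ≤ n, where n ∸ k is the true difference.
summand : ℕ → ℕ → Series
summand n k =
  _/_ (⟨ q ^ (n ∸ k ℕ.+ 1) ⨾ q ⟩ (2 ℕ.* k)) (⟨ q ^ 2 ⨾ q ^ 2 ⟩ k)
      {{q²-factorial-constantTermOne k}}
  * q ^ ((n ∸ k) C 2)

F : ℕ → Series
F n = ∑[ i ≤ n ] summand n (toℕ i)

{-# OPTIONS --safe #-}

-- Write a(n,k) for the k-th summand of F n, with a(n,k) = 0 for k > n. The
-- recurrence already holds term by term, with a shift of k: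
--   a(n,0)   = q²ⁿ⁻³ a(n-2,0),
--   a(n,k+1) = (1 - q²ⁿ⁻¹) a(n-1,k) + q²ⁿ⁻³ a(n-2,k+1).
-- After removing common factors the second line is, with A = q^(n-k-2),
-- B = q^(n-k-1) and Y = q^(2k+2), the identity
--   (1 - AY)(1 - BY) = (1 - ABY)(1 - Y) + Y(1 - A)(1 - B).
module Submission where

open import Algebra.Bundles using (CommutativeRing)
import Algebra.Properties.CommutativeSemigroup as CommutativeSemigroupProperties
import Algebra.Properties.Semiring.Exp as SemiringExp
import Algebra.Properties.Semiring.Sum as SemiringSum
import Algebra.Solver.Ring.NaturalCoefficients.Default as SemiringSolver
open import Data.Fin.Base using (toℕ)
open import Data.Nat.Base as ℕ using (ℕ; zero; suc; _≤_; _∸_; z≤n; s≤s)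
open import Data.Nat.Combinatorics using (_C_; nC1≡n; nCk+nC[k+1]≡[n+1]C[k+1])
import Data.Nat.Properties as ℕₚ
import Data.Nat.Tactic.RingSolver as ℕ-Solver
open import Relation.Binary.PropositionalEquality as ≡ using (_≡_)
import Relation.Binary.Reasoning.Setoid as SetoidReasoning

-- Identities in an arbitrary commutative ring

module RingIdentities {c ℓ} (R : CommutativeRing c ℓ) where
  open CommutativeRing R
  open SetoidReasoning setoid
  open SemiringSolver commutativeSemiring using (solve; con; _:=_; _:+_; _:*_)
  open import Algebra.Properties.Ring ring using (-‿distribʳ-*)

  1-xy≈[1-x]+x[1-y] : ∀ x y → 1# - x * y ≈ (1# - x) + x * (1# - y)
  1-xy≈[1-x]+x[1-y] x y = sym (begin
    (1# - x) + x * (1# - y)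
      -- The solver works in a commutative semiring, so negatives enter as independent variables and
      -- `x - x` is cancelled separately.
      ≈⟨ solve 3 (λ x x⁻ y⁻ → (con 1 :+ x⁻) :+ x :* (con 1 :+ y⁻) := (con 1 :+ x :* y⁻) :+ (x :+ x⁻))
           refl x (- x) (- y) ⟩
    (1# + x * - y) + (x - x)
      ≈⟨ +-cong (+-congˡ (sym (-‿distribʳ-* x y))) (-‿inverseʳ x) ⟩
    (1# - x * y) + 0#
      ≈⟨ +-identityʳ _ ⟩
    1# - x * y ∎)

  -- Only identities without subtraction are left once 1 - A, 1 - B and 1 - Y
  -- are taken as variables and every factor is expanded by 1-xy≈[1-x]+x[1-y].
  factor-identity : ∀ A B Y →
    (1# - A * Y) * (1# - B * Y) ≈
    (1# - A * (B * Y)) * (1# - Y) + Y * ((1# - A) * (1# - B))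
  factor-identity A B Y = begin
    (1# - A * Y) * (1# - B * Y)
      ≈⟨ *-cong 1-AY 1-BY ⟩
    (y + Y * a) * (b + B * y)
      ≈⟨ solve 5 (λ B Y a b y → (y :+ Y :* a) :* (b :+ B :* y) :=
           ((b :+ B :* y) :+ (B :* Y) :* a) :* y :+ Y :* (a :* b))
           refl B Y a b y ⟩
    ((b + B * y) + (B * Y) * a) * y + Y * (a * b)
      ≈⟨ +-congʳ (*-congʳ 1-ABY) ⟨
    (1# - A * (B * Y)) * y + Y * (a * b) ∎
    where
    a = 1# - A
    b = 1# - B
    y = 1# - Y
    1-AY : 1# - A * Y ≈ y + Y * a
    1-AY = trans (+-congˡ (-‿cong (*-comm A Y))) (1-xy≈[1-x]+x[1-y] Y A)
    1-BY : 1# - B * Y ≈ b + B * y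
    1-BY = 1-xy≈[1-x]+x[1-y] B Y
    1-ABY : 1# - A * (B * Y) ≈ (b + B * y) + (B * Y) * a
    1-ABY = trans (+-congˡ (-‿cong (*-comm A (B * Y))))
      (trans (1-xy≈[1-x]+x[1-y] (B * Y) A) (+-congʳ 1-BY))

  -- Boundary case, where a(n-2,k+1) = 0: of the two new factors, `g` is absorbed by the reciprocal
  -- and `f` becomes the coefficient 1 - q²ⁿ⁻¹.
  telescope-quotient : ∀ {N f g u v} Q → u ≈ v * g →
    (N * f) * g * v * Q ≈ f * (N * u * Q)
  telescope-quotient {N} {f} {g} {u} {v} Q u≈vg = begin
    (N * f) * g * v * Q
      ≈⟨ solve 5 (λ N f g v Q → (N :* f) :* g :* v :* Q := f :* (N :* (v :* g) :* Q))
           refl N f g v Q ⟩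
    f * (N * (v * g) * Q)
      ≈⟨ *-congˡ (*-congʳ (*-congˡ u≈vg)) ⟨
    f * (N * u * Q) ∎

  -- This is `factor-identity` times the common part `N * v * Q`. In the first product 1 - Y turns
  -- the reciprocal `v` into `u`; in the second, `Y * Q` is traded for `d * P`.
  split-quotient : ∀ {A B Y d N u v Q P} → u ≈ v * (1# - Y) → d * P ≈ Y * Q →
    (N * (1# - A * Y)) * (1# - B * Y) * v * Q ≈
    (1# - A * (B * Y)) * (N * u * Q) + d * (((1# - A) * ((1# - B) * N)) * v * P)
  split-quotient {A} {B} {Y} {d} {N} {u} {v} {Q} {P} u≈v[1-Y] dP≈YQ = begin
    (N * (1# - A * Y)) * (1# - B * Y) * v * Q
      ≈⟨ solve 5 (λ N s t v Q → (N :* s) :* t :* v :* Q := (s :* t) :* (N :* v :* Q))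
           refl N (1# - A * Y) (1# - B * Y) v Q ⟩
    ((1# - A * Y) * (1# - B * Y)) * (N * v * Q)
      ≈⟨ *-congʳ (factor-identity A B Y) ⟩
    (e * y + Y * (a * b)) * (N * v * Q)
      ≈⟨ solve 8 (λ e y Y a b N v Q → (e :* y :+ Y :* (a :* b)) :* (N :* v :* Q) :=
           e :* (N :* (v :* y) :* Q) :+ (a :* (b :* N)) :* v :* (Y :* Q))
           refl e y Y a b N v Q ⟩
    e * (N * (v * y) * Q) + (a * (b * N)) * v * (Y * Q)
      ≈⟨ +-cong (*-congˡ (*-congʳ (*-congˡ u≈v[1-Y]))) (*-congˡ dP≈YQ) ⟨
    e * (N * u * Q) + (a * (b * N)) * v * (d * P)
      ≈⟨ +-congˡ (solve 4 (λ m v d P → m :* v :* (d :* P) := d :* (m :* v :* P))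
           refl (a * (b * N)) v d P) ⟩
    e * (N * u * Q) + d * ((a * (b * N)) * v * P) ∎
    where
    a = 1# - A
    b = 1# - B
    y = 1# - Y
    e = 1# - A * (B * Y)

  recip-quotient : ∀ {D D′ u v g} → D * u ≈ 1# → D′ * v ≈ 1# → D′ ≈ D * g → u ≈ v * g
  recip-quotient {D} {D′} {u} {v} {g} Du≈1 D′v≈1 D′≈Dg = begin
    u                 ≈⟨ *-identityʳ u ⟨
    u * 1#            ≈⟨ *-congˡ D′v≈1 ⟨
    u * (D′ * v)      ≈⟨ *-congˡ (*-congʳ D′≈Dg) ⟩
    u * (D * g * v)   ≈⟨ solve 4 (λ u D g v → u :* (D :* g :* v) := (D :* u) :* (v :* g)) refl u D g v ⟩
    (D * u) * (v * g) ≈⟨ *-congʳ Du≈1 ⟩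
    1# * (v * g)      ≈⟨ *-identityˡ _ ⟩
    v * g             ∎

  combine-sums : ∀ c d {t t₁ t₂ s s₁ s₂} → t ≈ c * t₁ + d * t₂ → s ≈ c * s₁ + d * s₂ →
    t + s ≈ c * (t₁ + s₁) + d * (t₂ + s₂)
  combine-sums c d {t} {t₁} {t₂} {s} {s₁} {s₂} t≈ s≈ = trans (+-cong t≈ s≈)
    (solve 6 (λ c d t₁ t₂ s₁ s₂ → (c :* t₁ :+ d :* t₂) :+ (c :* s₁ :+ d :* s₂) :=
      c :* (t₁ :+ s₁) :+ d :* (t₂ :+ s₂)) refl c d t₁ t₂ s₁ s₂)

  -- Gives boundary cases the three-term shape that `combine-sums` expects.
  +-zero-summand : ∀ {t} x d → t ≈ x → t ≈ x + d * 0#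
  +-zero-summand x d t≈x = trans t≈x (sym (trans (+-congˡ (zeroʳ d)) (+-identityʳ x)))

  move-to-left : ∀ e d {x y z} → x ≈ (1# - e) * y + d * z → x + (e - 1#) * y - d * z ≈ 0#
  move-to-left e d {x} {y} {z} x≈ = begin
    x + (e - 1#) * y - d * z
      ≈⟨ +-congʳ (+-congʳ x≈) ⟩
    ((1# - e) * y + d * z) + (e - 1#) * y - d * z
      ≈⟨ solve 6 (λ e e⁻ o⁻ y w w⁻ → ((con 1 :+ e⁻) :* y :+ w) :+ (e :+ o⁻) :* y :+ w⁻ :=
           ((con 1 :+ o⁻) :+ (e :+ e⁻)) :* y :+ (w :+ w⁻))
           refl e (- e) (- 1#) y (d * z) (- (d * z)) ⟩
    ((1# - 1#) + (e - e)) * y + (d * z - d * z)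
      ≈⟨ +-cong (*-congʳ (+-cong (-‿inverseʳ 1#) (-‿inverseʳ e))) (-‿inverseʳ (d * z)) ⟩
    (0# + 0#) * y + 0#
      ≈⟨ solve 1 (λ y → (con 0 :+ con 0) :* y :+ con 0 := con 0) refl y ⟩
    0# ∎

-- The recurrence, first term by term and then summed

module FactorialSums {c ℓ} (R : CommutativeRing c ℓ) where
  open CommutativeRing R
  open SetoidReasoning setoid
  open RingIdentities R
  open SemiringExp semiring using (_^_; ^-homo-*; ^-assocʳ)
  open SemiringSum semiring using (sum; sum-cong-≗)
  private
    module +ₚ = CommutativeSemigroupProperties +-commutativeSemigroup
    module *ₚ = CommutativeSemigroupProperties *-commutativeSemigroup

  -- P j m stands for (qʲ ; q)ₘ and u k for 1 / (q² ; q²)ₖ.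
  module _ (q : Carrier) (P : ℕ → ℕ → Carrier) (u : ℕ → Carrier)
    (P-zero : ∀ j → P j 0 ≈ 1#)
    (P-suc : ∀ j m → P j (suc m) ≈ P j m * (1# - q ^ j * q ^ m))
    (u-suc : ∀ k → u k ≈ u (suc k) * (1# - q ^ 2 * (q ^ 2) ^ k))
    where

    q^-split : ∀ a b {c} → c ≡ a ℕ.+ b → q ^ c ≈ q ^ a * q ^ b
    q^-split a b ≡.refl = ^-homo-* q a b

    q^-regroup : ∀ a b c d → a ℕ.+ b ≡ c ℕ.+ d → q ^ a * q ^ b ≈ q ^ c * q ^ d
    q^-regroup a b c d eq = trans (sym (^-homo-* q a b)) (q^-split c d eq)

    1-cong : ∀ {x y} → x ≈ y → 1# - x ≈ 1# - y
    1-cong x≈y = +-congˡ (-‿cong x≈y)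

    -- The defining recursion splits off the last factor; the first one is reached by induction on
    -- `m`, since j + (m + 1) = (j + 1) + m.
    P-sucˡ : ∀ j m → P j (suc m) ≈ (1# - q ^ j) * P (suc j) m
    P-sucˡ j zero = begin
      P j 1                      ≈⟨ P-suc j 0 ⟩
      P j 0 * (1# - q ^ j * 1#)  ≈⟨ *-cong (trans (P-zero j) (sym (P-zero (suc j)))) (1-cong (*-identityʳ _)) ⟩
      P (suc j) 0 * (1# - q ^ j) ≈⟨ *-comm _ _ ⟩
      (1# - q ^ j) * P (suc j) 0 ∎
    P-sucˡ j (suc m) = begin
      P j (2 ℕ.+ m)
        ≈⟨ P-suc j (suc m) ⟩
      P j (suc m) * (1# - q ^ j * q ^ suc m)
        ≈⟨ *-cong (P-sucˡ j m) (1-cong (q^-regroup j (suc m) (suc j) m (ℕₚ.+-suc j m))) ⟩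
      (1# - q ^ j) * P (suc j) m * (1# - q ^ suc j * q ^ m)
        ≈⟨ *-assoc _ _ _ ⟩
      (1# - q ^ j) * (P (suc j) m * (1# - q ^ suc j * q ^ m))
        ≈⟨ *-congˡ (P-suc (suc j) m) ⟨
      (1# - q ^ j) * P (suc j) (suc m) ∎

    -- Two factors split off at the upper end: this compares a(n,k+1) with a(n-1,k), whose
    -- factorials start at the same power of q.
    P-2*suc : ∀ j k → P j (2 ℕ.* suc k) ≈
      (P j (2 ℕ.* k) * (1# - q ^ j * q ^ (2 ℕ.* k))) * (1# - q ^ j * q ^ suc (2 ℕ.* k))
    P-2*suc j k rewrite ℕₚ.*-suc 2 k = trans (P-suc j _) (*-congʳ (P-suc j _))

    -- Two factors split off at the lower end, to bring a(n-2,k+1) to the factorial shared by the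
    -- other two terms.
    P-2*sucˡ : ∀ j k → P j (2 ℕ.* suc k) ≈
      (1# - q ^ j) * ((1# - q ^ suc j) * P (2 ℕ.+ j) (2 ℕ.* k))
    P-2*sucˡ j k rewrite ℕₚ.*-suc 2 k = trans (P-sucˡ j _) (*-congˡ (P-sucˡ (suc j) _))

    u-quotient : ∀ k → u k ≈ u (suc k) * (1# - q ^ (2 ℕ.* suc k))
    u-quotient k = trans (u-suc k) (*-congˡ (1-cong (^-assocʳ q 2 (suc k))))

    -- The k-th summand of F (j + k).
    term : ℕ → ℕ → Carrier
    term j k = P (j ℕ.+ 1) (2 ℕ.* k) * u k * q ^ (j C 2)

    suc-C-2 : ∀ j → suc j C 2 ≡ j ℕ.+ j C 2
    suc-C-2 j = ≡.trans (≡.sym (nCk+nC[k+1]≡[n+1]C[k+1] j 1)) (≡.cong (ℕ._+ j C 2) (nC1≡n j))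

    -- Expanding C(j+2,2) as (j + 1) + j + C(j,2) leaves a linear condition on exponents, in which
    -- C(j,2) can be treated as a variable.
    q^-C-2 : ∀ a b j → a ℕ.+ j C 2 ≡ b ℕ.+ (suc j ℕ.+ (j ℕ.+ j C 2)) →
      q ^ a * q ^ (j C 2) ≈ q ^ b * q ^ ((2 ℕ.+ j) C 2)
    q^-C-2 a b j eq rewrite suc-C-2 (suc j) | suc-C-2 j = q^-regroup a (j C 2) b _ eq

    term-zero : ∀ m → term (2 ℕ.+ m) 0 ≈ q ^ (1 ℕ.+ 2 ℕ.* m) * term m 0
    term-zero m = begin
      P (2 ℕ.+ m ℕ.+ 1) 0 * u 0 * q ^ ((2 ℕ.+ m) C 2)
        ≈⟨ *-cong
             (*-congʳ (trans (P-zero _) (sym (P-zero _))))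
             (trans (sym (*-identityˡ _)) (sym (q^-C-2 (1 ℕ.+ 2 ℕ.* m) 0 m (ex m (m C 2))))) ⟩
      P (m ℕ.+ 1) 0 * u 0 * (q ^ (1 ℕ.+ 2 ℕ.* m) * q ^ (m C 2))
        ≈⟨ *ₚ.x∙yz≈y∙xz _ _ _ ⟩
      q ^ (1 ℕ.+ 2 ℕ.* m) * term m 0 ∎
      where
      ex : ∀ m t → 1 ℕ.+ 2 ℕ.* m ℕ.+ t ≡ suc m ℕ.+ (m ℕ.+ t)
      ex = ℕ-Solver.solve-∀

    -- e and d are 1 - q²ⁿ⁻¹ and q²ⁿ⁻³ for n = m + 2.
    module _ (m : ℕ) where
      e = 1# - q ^ (3 ℕ.+ 2 ℕ.* m)
      d = q ^ (1 ℕ.+ 2 ℕ.* m)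

      -- Here n = k + 1, and the new factors are 1 - q²ᵏ⁺¹ = `e` and 1 - q²ᵏ⁺², which cancels.
      term-suc₀ : ∀ k → k ≡ suc m → term 0 (suc k) ≈ e * term 0 k
      term-suc₀ k ≡.refl = begin
        term 0 (suc k)
          ≈⟨ *-congʳ (*-congʳ (trans (P-2*suc 1 k) (*-cong
               (*-congˡ (1-cong (sym (q^-split 1 (2 ℕ.* k) (ex m)))))
               (1-cong (sym (q^-split 1 (suc (2 ℕ.* k)) (ℕₚ.*-suc 2 k))))))) ⟩
        (P 1 (2 ℕ.* k) * e) * (1# - q ^ (2 ℕ.* suc k)) * u (suc k) * q ^ 0
          ≈⟨ telescope-quotient (q ^ 0) (u-quotient k) ⟩
        e * term 0 k ∎
        where
        ex : ∀ m → 3 ℕ.+ 2 ℕ.* m ≡ 1 ℕ.+ 2 ℕ.* suc m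
        ex = ℕ-Solver.solve-∀

      term-suc₁ : ∀ k → k ≡ m → term 1 (suc k) ≈ e * term 1 k
      term-suc₁ k ≡.refl = begin
        term 1 (suc k)
          ≈⟨ *-congʳ (*-congʳ (trans (P-2*suc 2 k) (trans
               (*-cong
                 (*-congˡ (1-cong (sym (q^-split 2 (2 ℕ.* k) (ℕₚ.*-suc 2 k)))))
                 (1-cong (sym (q^-split 2 (suc (2 ℕ.* k)) (ex m)))))
               -- Now n = k + 2, so the first new factor cancels and the second is `e`; they are
               -- swapped.
               (*ₚ.xy∙z≈xz∙y _ _ _)))) ⟩
        (P 2 (2 ℕ.* k) * e) * (1# - q ^ (2 ℕ.* suc k)) * u (suc k) * q ^ 0
          ≈⟨ telescope-quotient (q ^ 0) (u-quotient k) ⟩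
        e * term 1 k ∎
        where
        ex : ∀ m → 3 ℕ.+ 2 ℕ.* m ≡ 2 ℕ.+ suc (2 ℕ.* m)
        ex = ℕ-Solver.solve-∀

      term-suc₂ : ∀ i k → suc i ℕ.+ k ≡ m →
        term (2 ℕ.+ i) (suc k) ≈ e * term (2 ℕ.+ i) k + d * term i (suc k)
      term-suc₂ i k ≡.refl = begin
        term (2 ℕ.+ i) (suc k)
          ≈⟨ *-congʳ (*-congʳ (trans (P-2*suc (2 ℕ.+ i ℕ.+ 1) k) (*-cong
               (*-congˡ (1-cong (q^-regroup (2 ℕ.+ i ℕ.+ 1) (2 ℕ.* k) (i ℕ.+ 1) (2 ℕ.* suc k) (ex₁ i k))))
               (1-cong (q^-regroup (2 ℕ.+ i ℕ.+ 1) (suc (2 ℕ.* k)) (suc (i ℕ.+ 1)) (2 ℕ.* suc k) (ex₂ i k)))))) ⟩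
        (N * (1# - A * Y)) * (1# - B * Y) * u (suc k) * q ^ ((2 ℕ.+ i) C 2)
          ≈⟨ split-quotient (u-quotient k) (q^-C-2 (1 ℕ.+ 2 ℕ.* m) (2 ℕ.* suc k) i (ex₃ i k (i C 2))) ⟩
        (1# - A * (B * Y)) * term (2 ℕ.+ i) k + d * (((1# - A) * ((1# - B) * N)) * u (suc k) * q ^ (i C 2))
          ≈⟨ +-cong
               (*-congʳ (1-cong (trans (*-congˡ (sym (^-homo-* q (suc (i ℕ.+ 1)) (2 ℕ.* suc k))))
                 (sym (q^-split (i ℕ.+ 1) (suc (i ℕ.+ 1) ℕ.+ 2 ℕ.* suc k) (ex₄ i k))))))
               (*-congˡ (*-congʳ (*-congʳ (sym (P-2*sucˡ (i ℕ.+ 1) k))))) ⟩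
        e * term (2 ℕ.+ i) k + d * term i (suc k) ∎
        where
        A = q ^ (i ℕ.+ 1)
        B = q ^ suc (i ℕ.+ 1)
        Y = q ^ (2 ℕ.* suc k)
        N = P (2 ℕ.+ i ℕ.+ 1) (2 ℕ.* k)
        ex₁ : ∀ i k → 2 ℕ.+ i ℕ.+ 1 ℕ.+ 2 ℕ.* k ≡ i ℕ.+ 1 ℕ.+ 2 ℕ.* suc k
        ex₁ = ℕ-Solver.solve-∀
        ex₂ : ∀ i k → 2 ℕ.+ i ℕ.+ 1 ℕ.+ suc (2 ℕ.* k) ≡ suc (i ℕ.+ 1) ℕ.+ 2 ℕ.* suc k
        ex₂ = ℕ-Solver.solve-∀
        ex₃ : ∀ i k t → 1 ℕ.+ 2 ℕ.* (suc i ℕ.+ k) ℕ.+ t ≡ 2 ℕ.* suc k ℕ.+ (suc i ℕ.+ (i ℕ.+ t))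
        ex₃ = ℕ-Solver.solve-∀
        ex₄ : ∀ i k → 3 ℕ.+ 2 ℕ.* (suc i ℕ.+ k) ≡ i ℕ.+ 1 ℕ.+ (suc (i ℕ.+ 1) ℕ.+ 2 ℕ.* suc k)
        ex₄ = ℕ-Solver.solve-∀

    -- The last `j` summands of F n, from index `k` on, where n + 1 = j + k. Counting the remaining
    -- summands makes the recursion structural.
    diagonalSum : ℕ → ℕ → Carrier
    diagonalSum zero    k = 0#
    diagonalSum (suc j) k = term j k + diagonalSum j (suc k)

    -- The truncation in j ∸ 2 is harmless: for j ≤ 2 the last sum is empty.
    diagonalSum-suc : ∀ m j k → j ℕ.+ k ≡ 2 ℕ.+ m →
      diagonalSum j (suc k) ≈ e m * diagonalSum j k + d m * diagonalSum (j ∸ 2) (suc k)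
    diagonalSum-suc m 0 k eq = +-zero-summand _ (d m) (sym (zeroʳ (e m)))
    diagonalSum-suc m 1 k eq = +-zero-summand _ (d m) (begin
      term 0 (suc k) + 0#       ≈⟨ +-cong (term-suc₀ m k (ℕₚ.suc-injective eq)) (sym (zeroʳ (e m))) ⟩
      e m * term 0 k + e m * 0# ≈⟨ distribˡ _ _ _ ⟨
      e m * (term 0 k + 0#)     ∎)
    diagonalSum-suc m 2 k eq = trans
      (combine-sums (e m) (d m)
        (+-zero-summand _ (d m) (term-suc₁ m k (ℕₚ.suc-injective (ℕₚ.suc-injective eq))))
        (diagonalSum-suc m 1 (suc k) eq))
      -- Neither of the two summands contributes a `d` part, so `0# + 0#` is collapsed.
      (+-congˡ (*-congˡ (+-identityˡ 0#)))
    diagonalSum-suc m (suc (suc (suc i))) k eq = combine-sums (e m) (d m)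
      (term-suc₂ m i k (ℕₚ.suc-injective (ℕₚ.suc-injective eq)))
      (diagonalSum-suc m (suc (suc i)) (suc k) (≡.trans (ℕₚ.+-suc (2 ℕ.+ i) k) eq))

    -- The leading terms of F n and F (n-2) match by `term-zero`; the shifted rest of F n yields all
    -- of F (n-1) and the rest of F (n-2).
    diagonalSum-recurrence : ∀ m → diagonalSum (3 ℕ.+ m) 0 ≈
      e m * diagonalSum (2 ℕ.+ m) 0 + d m * diagonalSum (1 ℕ.+ m) 0
    diagonalSum-recurrence m = begin
      term (2 ℕ.+ m) 0 + diagonalSum (2 ℕ.+ m) 1
        ≈⟨ +-cong (term-zero m) (diagonalSum-suc m (2 ℕ.+ m) 0 (ℕₚ.+-identityʳ _)) ⟩
      d m * term m 0 + (e m * diagonalSum (2 ℕ.+ m) 0 + d m * diagonalSum m 1)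
        ≈⟨ +ₚ.x∙yz≈y∙xz _ _ _ ⟩
      e m * diagonalSum (2 ℕ.+ m) 0 + (d m * term m 0 + d m * diagonalSum m 1)
        ≈⟨ +-congˡ (distribˡ _ _ _) ⟨
      e m * diagonalSum (2 ℕ.+ m) 0 + d m * diagonalSum (1 ℕ.+ m) 0 ∎

    -- The offset `k` is general because removing the first summand raises it by one.
    sum≡diagonalSum : ∀ n k →
      sum {suc n} (λ i → term (n ∸ toℕ i) (toℕ i ℕ.+ k)) ≡ diagonalSum (suc n) k
    sum≡diagonalSum zero    k = ≡.refl
    sum≡diagonalSum (suc n) k = ≡.cong (term (suc n) k +_) (≡.trans
      (sum-cong-≗ {suc n} (λ i → ≡.cong (term (n ∸ toℕ i)) (≡.sym (ℕₚ.+-suc (toℕ i) k))))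
      (sum≡diagonalSum n (suc k)))

    module _ (G : ℕ → Carrier)
      (G≡sum : ∀ n → G n ≡ sum {suc n} (λ i → term (n ∸ toℕ i) (toℕ i)))
      where

      G≡diagonalSum : ∀ n → G n ≡ diagonalSum (suc n) 0
      G≡diagonalSum n = ≡.trans (G≡sum n) (≡.trans
        (sum-cong-≗ {suc n} (λ i → ≡.cong (term (n ∸ toℕ i)) (≡.sym (ℕₚ.+-identityʳ (toℕ i)))))
        (sum≡diagonalSum n 0))

      factorialSum-recurrence : ∀ m {a b} → a ≡ 3 ℕ.+ 2 ℕ.* m → b ≡ 1 ℕ.+ 2 ℕ.* m →
        G (2 ℕ.+ m) + (q ^ a - 1#) * G (1 ℕ.+ m) - q ^ b * G m ≈ 0#
      factorialSum-recurrence m ≡.refl ≡.refl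
        rewrite G≡diagonalSum (2 ℕ.+ m) | G≡diagonalSum (1 ℕ.+ m) | G≡diagonalSum m
        = move-to-left (q ^ (3 ℕ.+ 2 ℕ.* m)) (d m) (diagonalSum-recurrence m)

-- Specialization to integer power series

open import Defs

recip-q²-factorial-suc : ∀ k → recip (⟨ q ^ 2 ⨾ q ^ 2 ⟩ k) ≈
  recip (⟨ q ^ 2 ⨾ q ^ 2 ⟩ suc k) * (1# - q ^ 2 * (q ^ 2) ^ k)
recip-q²-factorial-suc k =
  RingIdentities.recip-quotient ℤ⟦q⟧ {D k} {D (suc k)} {recip (D k)} {recip (D (suc k))}
    {1# - q ^ 2 * (q ^ 2) ^ k}
    (*-recip (D k) (q²-factorial-constantTermOne k))
    (*-recip (D (suc k)) (q²-factorial-constantTermOne (suc k)))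
    (λ _ → ≡.refl)
  where
  D : ℕ → Series
  D k = ⟨ q ^ 2 ⨾ q ^ 2 ⟩ k

corollary3p3 : (n : ℕ) → 2 ≤ n →
    F n + (q ^ (2 ℕ.* n ∸ 1) - 1#) * F (n ∸ 1) - q ^ (2 ℕ.* n ∸ 3) * F (n ∸ 2) ≈ 0#
corollary3p3 (suc (suc m)) (s≤s (s≤s z≤n)) =
  FactorialSums.factorialSum-recurrence ℤ⟦q⟧
    q (λ j m → ⟨ q ^ j ⨾ q ⟩ m) (λ k → recip (⟨ q ^ 2 ⨾ q ^ 2 ⟩ k))
    (λ _ _ → ≡.refl) (λ _ _ _ → ≡.refl) recip-q²-factorial-suc
    F (λ _ → ≡.refl) m
    -- With n = m + 2, rewriting 2n as 4 + 2m shows that neither subtraction truncates.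
    (≡.cong (_∸ 1) 2*[2+m]≡4+2*m) (≡.cong (_∸ 3) 2*[2+m]≡4+2*m)
  where
  2*[2+m]≡4+2*m : 2 ℕ.* (2 ℕ.+ m) ≡ 4 ℕ.+ 2 ℕ.* m
  2*[2+m]≡4+2*m = ℕₚ.*-distribˡ-+ 2 2 m
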